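{- Let $G$ be a ribbon graph and $v$ a vertex of $G$. (1) Let $e_1, e_2$ be edges incident to $v$ and let $\beta_1 = \beta_{(v,e_1)}$, $\beta_2 = \beta_{(v,e_2)}$ be the corresponding Bernardi bijections $S(G) \to B(G)$. Then there exists $\gamma_0 \in \operatorname{Pic}^0(G)$ such that $\beta_2(T) = \gamma_0 \cdot \beta_1(T)$ for all $T \in S(G)$. (2) The action $\operatorname{Pic}^0(G) \times S(G) \to S(G)$ defined by $\gamma \cdot T := \beta_{(v,e)}^{ -1}\left(\gamma \cdot \beta_{(v,e)}(T)\right)$, for an edge $e$ incident to $v$, depends only on $v$ and not on the choice of $e$.
   Context: A graph means a finite connected multigraph without loop edges; a ribbon graph is a graph with a cyclic ordering of the edges around each vertex. $S(G)$ is the set of spanning trees. Divisors are formal integer combinations of vertices; $\operatorname{Div}^d(G)$ those of degree $d$. For $f : V(G) \to \mathbb{Z}$, $\Delta f = \sum_{u} \big(\sum_{\text{edges } uw} (f(u)-f(w))\big)(u)$; principal divisors are those of the form $\Delta f$; $D \sim D'$ if $D - D'$ is principal. $\operatorname{Pic}^d(G)$ is the set of linear equivalence classes of degree-$d$ divisors; $\operatorname{Pic}^0(G)$ is a group acting on $\operatorname{Pic}^d(G)$ by addition. The genus is $g = |E(G)|-|V(G)|+1$. For a spanning tree $T$ with non-tree edges $e_1,\dots,e_g$, a $T$-break divisor is $\sum_i (v_i)$ with $v_i$ an endpoint of $e_i$; a break divisor is a $T$-break divisor for some $T$; $B(G)$ is the set of break divisors. Every class in $\operatorname{Pic}^g(G)$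 contains exactly one break divisor, so $\operatorname{Pic}^0(G)$ acts simply transitively on $B(G)$ by $\gamma \cdot D :=$ the unique break divisor linearly equivalent to $D + \gamma$. Bernardi map: for a vertex $v$, an edge $e$ incident to $v$, and a spanning tree $T$, the tour starts at $v$ and examines edges at $v$ in cyclic order starting with $e$; at a current vertex $u$, an examined edge $f \notin T$ is "cut through" from $u$ and the next edge at $u$ is examined, while an examined edge $f \in T$ is walked along to its other endpoint $u'$, after which the edges at $u'$ are examined in cyclic order starting with the edge after $f$. The tour ends when each tree edge has been traversed in both directions. For $f \notin T$, $\eta_{(v,e)}(f)$ is the endpoint from which $f$ is first cut through, and $\beta_{(v,e)}(T) = \sum_{f \notin T} (\eta_{(v,e)}(f)) \in B(G)$. The map $\beta_{(v,e)} : S(G) \to B(G)$ is a bijection. -}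

module Defs where

open import Algebra.Properties.CommutativeMonoid.Sum using (sum-cong-≗; ∑-distrib-+)
open import Algebra.Properties.Semiring.Sum using (*-distribˡ-sum)
open import Data.Bool.Base using (Bool; true; false; not; if_then_else_)
open import Data.Bool.Properties using () renaming (_≟_ to _≟ᵇ_)
open import Data.Fin.Base using (Fin)
open import Data.Fin.Properties using (_≟_)
open import Data.Fin.Subset using (Subset; ⊤; _∈_; _∉_)
open import Data.Fin.Subset.Properties using (_∈?_)
open import Data.Integer.Base as ℤ using (ℤ; 0ℤ; 1ℤ; -1ℤ)
open import Data.Integer.Properties as ℤ using (+-0-commutativeMonoid; +-*-semiring)
open import Data.Integer.Tactic.RingSolver using (solve-∀)
open import Data.List.Base using (List; []; _∷_; map; filter; find; cartesianProduct; allFin)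
open import Data.List.Relation.Unary.Unique.Propositional using (Unique)
open import Data.Maybe.Base using (Maybe; maybe′)
import Data.Maybe.Base as Maybe
open import Data.Nat.Base using (ℕ; zero; suc; _*_)
open import Data.Nat.GeneralisedArithmetic using (iterate)
open import Data.Product.Base using (Σ; Σ-syntax; ∃-syntax; _×_; _,_; proj₁; proj₂)
open import Data.Product.Properties using (≡-dec)
open import Level using (0ℓ)
open import Relation.Binary.Bundles using (Setoid)
open import Relation.Binary.Definitions using (DecidableEquality)
open import Relation.Binary.PropositionalEquality
open import Relation.Nullary.Decidable.Core using (does; ¬?)
open import Relation.Nullary.Negation.Core using (¬_)

open import Algebra.Properties.CommutativeMonoid.Sum +-0-commutativeMonoid public
  using (sum)

-- A dart (e , b) is an edge together with a choice of one of its two ends.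
-- As there are no loops, a dart d is the same thing as a pair (v , e) of a
-- vertex and an incident edge, where v = end d and e = edge d.
module Darts {n m : ℕ} (end : Fin m × Bool → Fin n) where

  Vertex Edge Dart : Set
  Vertex = Fin n
  Edge   = Fin m
  Dart   = Fin m × Bool

  edge : Dart → Edge
  edge = proj₁

  opposite : Dart → Dart
  opposite (e , b) = e , not b

  _≟ᵈ_ : DecidableEquality Dart
  _≟ᵈ_ = ≡-dec _≟_ _≟ᵇ_

  -- Walk T u ds w : the darts ds are traversed, each from its own end to the
  -- opposite one, leading from u to w along edges of T.
  data Walk (T : Subset m) : Vertex → List Dart → Vertex → Set where
    stop : ∀ {u} → Walk T u [] u
    step : ∀ {u w ds} d → end d ≡ u → edge d ∈ T →
           Walk T (end (opposite d)) ds w → Walk T u (d ∷ ds) w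

  Connected : Subset m → Set
  Connected T = ∀ u w → ∃[ ds ] Walk T u ds w

  Acyclic : Subset m → Set
  Acyclic T = ∀ u d ds → Walk T u (d ∷ ds) u →
              Unique (map edge (d ∷ ds)) → ¬ Unique (map end (d ∷ ds))

record RibbonGraph : Set where
  field
    n m : ℕ
    end : Fin m × Bool → Fin n

  open Darts end public

  field
    loopless  : ∀ d → end d ≢ end (opposite d)
    connected : Connected ⊤
    -- `next` is the cyclic ordering of the edges around each vertex: since
    -- every dart at a vertex is reached from every other one, it is on each
    -- of these finite sets a permutation with a single cycle.
    next      : Dart → Dart
    next-end  : ∀ d → end (next d) ≡ end d
    cyclic    : ∀ d d′ → end d ≡ end d′ → ∃[ k ] iterate next d k ≡ d′

module Bernardi (G : RibbonGraph) where
  open RibbonGraph G public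

  SpanningTree : Set
  SpanningTree = Σ[ T ∈ Subset m ] Connected T × Acyclic T

  Divisor : Set
  Divisor = Vertex → ℤ

  degree : Divisor → ℤ
  degree D = sum D

  ⟦_⟧ : Vertex → Divisor
  ⟦ v ⟧ u = if does (u ≟ v) then 1ℤ else 0ℤ

  difference : (Vertex → ℤ) → Vertex → Dart → ℤ
  difference f u d = ⟦ end d ⟧ u ℤ.* (f (end d) ℤ.- f (end (opposite d)))

  -- An edge uw contributes f u - f w at its end u and f w - f u at its
  -- end w.
  Δ : (Vertex → ℤ) → Divisor
  Δ f u = sum λ e → difference f u (e , false) ℤ.+ difference f u (e , true)

  _∼_ : Divisor → Divisor → Set
  D ∼ D′ = ∃[ f ] ∀ u → D u ℤ.- D′ u ≡ Δ f u

  private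
    Δ-+ : ∀ f g u → Δ (λ x → f x ℤ.+ g x) u ≡ Δ f u ℤ.+ Δ g u
    Δ-+ f g u = trans
      (sum-cong-≗ +-0-commutativeMonoid {m} λ e →
        lemma (⟦ end (e , false) ⟧ u) (⟦ end (e , true) ⟧ u)
              (f (end (e , false))) (f (end (e , true)))
              (g (end (e , false))) (g (end (e , true))))
      (∑-distrib-+ +-0-commutativeMonoid {m}
        (λ e → difference f u (e , false) ℤ.+ difference f u (e , true))
        (λ e → difference g u (e , false) ℤ.+ difference g u (e , true)))
      where
      lemma : ∀ a b p q r s →
        a ℤ.* ((p ℤ.+ r) ℤ.- (q ℤ.+ s)) ℤ.+ b ℤ.* ((q ℤ.+ s) ℤ.- (p ℤ.+ r)) ≡
        (a ℤ.* (p ℤ.- q) ℤ.+ b ℤ.* (q ℤ.- p)) ℤ.+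
        (a ℤ.* (r ℤ.- s) ℤ.+ b ℤ.* (s ℤ.- r))
      lemma = solve-∀

    Δ-scale : ∀ c f u → Δ (λ x → c ℤ.* f x) u ≡ c ℤ.* Δ f u
    Δ-scale c f u = trans
      (sum-cong-≗ +-0-commutativeMonoid {m} λ e →
        lemma c (⟦ end (e , false) ⟧ u) (⟦ end (e , true) ⟧ u)
              (f (end (e , false))) (f (end (e , true))))
      (sym (*-distribˡ-sum +-*-semiring {m} c
        (λ e → difference f u (e , false) ℤ.+ difference f u (e , true))))
      where
      lemma : ∀ c a b p q →
        a ℤ.* (c ℤ.* p ℤ.- c ℤ.* q) ℤ.+ b ℤ.* (c ℤ.* q ℤ.- c ℤ.* p) ≡
        c ℤ.* (a ℤ.* (p ℤ.- q) ℤ.+ b ℤ.* (q ℤ.- p))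
      lemma = solve-∀

  ∼-refl : ∀ {D} → D ∼ D
  ∼-refl {D} = (λ _ → 0ℤ ℤ.* 0ℤ) , λ u →
    trans (ℤ.+-inverseʳ (D u)) (sym (Δ-scale 0ℤ (λ _ → 0ℤ) u))

  ∼-sym : ∀ {D D′} → D ∼ D′ → D′ ∼ D
  ∼-sym {D} {D′} (f , p) = (λ x → -1ℤ ℤ.* f x) , λ u →
    trans (lemma (D u) (D′ u)) (trans (cong (-1ℤ ℤ.*_) (p u)) (sym (Δ-scale -1ℤ f u)))
    where
    lemma : ∀ a b → b ℤ.- a ≡ -1ℤ ℤ.* (a ℤ.- b)
    lemma = solve-∀

  ∼-trans : ∀ {D D′ D″} → D ∼ D′ → D′ ∼ D″ → D ∼ D″
  ∼-trans {D} {D′} {D″} (f , p) (g , q) = (λ x → f x ℤ.+ g x) , λ u →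
    trans (lemma (D u) (D′ u) (D″ u)) (trans (cong₂ ℤ._+_ (p u) (q u)) (sym (Δ-+ f g u)))
    where
    lemma : ∀ a b c → a ℤ.- c ≡ (a ℤ.- b) ℤ.+ (b ℤ.- c)
    lemma = solve-∀

  -- A class is given by a representative; the equality of the setoid is ∼.
  Pic : ℤ → Setoid 0ℓ 0ℓ
  Pic k = record
    { Carrier       = Σ[ D ∈ Divisor ] degree D ≡ k
    ; _≈_           = λ D D′ → proj₁ D ∼ proj₁ D′
    ; isEquivalence = record
        { refl  = λ {D} → ∼-refl {proj₁ D}
        ; sym   = λ {D} {D′} → ∼-sym {proj₁ D} {proj₁ D′}
        ; trans = λ {D} {D′} {D″} → ∼-trans {proj₁ D} {proj₁ D′} {proj₁ D″}
        }
    }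

  Pic⁰ : Set
  Pic⁰ = Setoid.Carrier (Pic 0ℤ)

  sumOutside : Subset m → (Edge → Divisor) → Divisor
  sumOutside T D u = sum λ e → if does (e ∈? T) then 0ℤ else D e u

  -- `side` selects an end of every edge; only its values off T matter.
  IsBreak : Divisor → Set
  IsBreak D = Σ[ T ∈ SpanningTree ] Σ[ side ∈ (Edge → Bool) ]
    D ≗ sumOutside (proj₁ T) (λ e → ⟦ end (e , side e) ⟧)

  -- γ · D ≐ D′ : for the break divisor D, the divisor D′ is the unique break
  -- divisor linearly equivalent to D + γ. Divisors being functions, they are
  -- compared pointwise.
  record _·_≐_ (γ : Pic⁰) (D D′ : Divisor) : Set where
    field
      source-break : IsBreak D
      target-break : IsBreak D′
      equivalent   : D′ ∼ (λ u → D u ℤ.+ proj₁ γ u)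
      unique       : ∀ D″ → IsBreak D″ → D″ ∼ (λ u → D u ℤ.+ proj₁ γ u) → D″ ≗ D′

  -- The dart examined after d: if the edge of d is in T, it is walked along,
  -- and the edge after it at its other end is next; otherwise it is cut
  -- through, and the next edge at the same vertex is examined.
  advance : Subset m → Dart → Dart
  advance T d = if does (edge d ∈? T) then next (opposite d) else next d

  treeDarts : Subset m → List Dart
  treeDarts T = filter (λ d → edge d ∈? T) (cartesianProduct (allFin m) (false ∷ true ∷ []))

  -- The darts examined, in order. `pending` lists the darts of T not yet
  -- walked along; the tour ends when none is left. The first argument bounds
  -- the number of steps.
  tourFrom : ℕ → Subset m → (pending : List Dart) → Dart → List Dart
  tourFrom zero    T pending   d = []
  tourFrom (suc k) T []        d = []
  tourFrom (suc k) T (p ∷ ps)  d =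
    d ∷ tourFrom k T (filter (λ d′ → ¬? (d′ ≟ᵈ d)) (p ∷ ps)) (advance T d)

  -- `advance T` permutes the 2m darts, and for a spanning tree T it has a
  -- single cycle, so that 2m steps always suffice to complete the tour.
  tour : Subset m → Dart → List Dart
  tour T d = tourFrom (2 * m) T (treeDarts T) d

  -- For f ∉ T, the vertex from which f is first cut through in the tour
  -- starting at (end d , edge d). The value is `nothing` only if f is never
  -- examined, which does not happen when T is a spanning tree.
  η : Dart → Subset m → Edge → Maybe Vertex
  η d T f = Maybe.map end (find (λ d′ → edge d′ ≟ f) (tour T d))

  -- β d is the Bernardi map of the vertex end d and the edge edge d.
  β : Dart → SpanningTree → Divisor
  β d (T , _) = sumOutside T (λ f → maybe′ ⟦_⟧ (λ _ → 0ℤ) (η d T f))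

  -- The graph of the action through β d: as β d is a bijection onto the break
  -- divisors, T′ = (β d)⁻¹ (γ · β d T) means β d T′ = γ · β d T.
  _·[_]_≐_ : Pic⁰ → Dart → SpanningTree → SpanningTree → Set
  γ ·[ d ] T ≐ T′ = γ · β d T ≐ β d T′

{-# OPTIONS --safe #-}

-- It suffices to compare the tours from d and from the next dart at the same
-- vertex. If d is not in T, only the edge of d changes its first dart. If d is
-- in T, deleting it splits T in two components, and each tour runs through the
-- darts at one component before those at the other, in opposite orders. The two
-- values of β then differ by Δ of the indicator function of a component, up to
-- (opposite end of d) - (end of d), which does not depend on T.
--
-- Linearly equivalent break divisors D, D′ are equal: for a vertex q,
-- D + Σ (u) - (q) is the indegree divisor of an orientation in which every
-- vertex is reachable from q along the tree. If D - D′ = Δ φ, pairing with φ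
-- gives Σ (φ x - φ y)² = Σ (φ (head e) - φ (head′ e)) over the edges e = xy.
-- Comparing termwise, φ does not decrease along the first orientation and does
-- not increase along the second. Hence φ q is both its minimum and its maximum.

module Submission where

open import Defs
open import Algebra.Properties.CommutativeMonoid.Sum using (sum-cong-≗; ∑-distrib-+; ∑-comm; sum-replicate-zero)
open import Algebra.Properties.Semiring.Sum using (*-distribˡ-sum)
open import Data.Bool.Base using (Bool; true; false; not; if_then_else_)
open import Data.Bool.Properties using (not-involutive; not-¬; ¬-not) renaming (_≟_ to _≟ᵇ_)
open import Data.Empty using (⊥; ⊥-elim)
open import Data.Fin.Base using (suc; Fin; zero; toℕ; combine)
open import Data.Fin.Properties using (_≟_; pigeonhole; combine-injective; toℕ≤pred[n])
open import Data.Fin.Subset using (Subset; _∈_; _∉_; _-_; ⁅_⁆)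
open import Data.Fin.Subset.Properties using (_∈?_; p─q⊆p; x∈p∧x≢y⇒x∈p-y)
open import Data.Integer.Base as ℤ using (ℤ; 0ℤ; 1ℤ; -1ℤ; +≤+; -≤+)
open import Data.Integer.Properties as ℤ using (+-0-commutativeMonoid; +-*-semiring)
open import Data.Integer.Tactic.RingSolver using (solve-∀)
open import Data.List.Base using (List; []; _∷_; _++_; map; filter; allFin; find)
open import Data.List.Membership.Propositional using () renaming (_∈_ to _∈ˡ_; _∉_ to _∉ˡ_)
open import Data.List.Membership.Propositional.Properties using (∈-filter⁺; ∈-allFin; ∈-map⁺; ∈-map⁻; ∈-cartesianProduct⁺)
open import Data.List.Relation.Unary.All as All using (All; []; _∷_)
open import Data.List.Relation.Unary.All.Properties using (all-filter; ¬Any⇒All¬; All¬⇒¬Any)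
open import Data.List.Relation.Unary.AllPairs using ([]; _∷_)
open import Data.List.Relation.Unary.Any using (here; there; any?)
open import Data.List.Relation.Unary.Unique.Propositional using (Unique)
open import Data.Maybe.Base as Maybe using (just; maybe′)
open import Data.Nat.Base as ℕ using (ℕ; zero; suc; _+_; _*_; _<_; _≤_; z≤n; s≤s⁻¹)
open import Data.Nat.GeneralisedArithmetic using (iterate)
open import Data.Nat.Properties as ℕ using (m≤n⇒∃[o]m+o≡n; +-comm; +-monoˡ-<; m≤n⇒m<n∨m≡n; ≤-<-trans; <-≤-trans)
open import Data.Product.Base using (Σ-syntax; ∃-syntax; _×_; _,_; proj₁; proj₂; ∃₂)
open import Data.Sum.Base using (_⊎_; inj₁; inj₂; [_,_]′)
open import Data.Vec.Base using (_∷_; there)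
open import Function.Base using (_∘_; id)
open import Function.Bundles using (_⇔_; mk⇔)
open import Relation.Binary.PropositionalEquality
open import Relation.Nullary.Decidable using (dec-true; dec-false)
open import Relation.Nullary.Decidable.Core using (Dec; yes; no; does; ¬?)
open import Relation.Nullary.Negation.Core using (¬_; contradiction)

-- Walks, components of a subgraph, and the two sides of a tree edge

x∉p-x : ∀ {k} (p : Subset k) x → x ∉ p - x
x∉p-x (_ ∷ p) (suc x) (there x∈) = x∉p-x p x x∈

module Cuts (G : RibbonGraph) where
  open Bernardi G public

  opposite-involutive : ∀ d → opposite (opposite d) ≡ d
  opposite-involutive (e , b) = cong (e ,_) (not-involutive b)

  walk-++ : ∀ {S x y z ds es} → Walk S x ds y → Walk S y es z → Walk S x (ds ++ es) z
  walk-++ stop            w′ = w′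
  walk-++ (step d p e∈ w) w′ = step d p e∈ (walk-++ w w′)

  walk-reverse : ∀ {S x y ds} → Walk S x ds y → ∃[ es ] Walk S y es x
  walk-reverse stop = [] , stop
  walk-reverse (step d refl e∈ w) =
    _ , walk-++ (proj₂ (walk-reverse w))
          (step (opposite d) refl e∈
            (subst (λ d′ → Walk _ (end d′) [] (end d)) (sym (opposite-involutive d)) stop))

  walk-⊆ : ∀ {S S′ x y ds} → (∀ {e} → e ∈ S → e ∈ S′) → Walk S x ds y → Walk S′ x ds y
  walk-⊆ S⊆S′ stop            = stop
  walk-⊆ S⊆S′ (step d p e∈ w) = step d p (S⊆S′ e∈) (walk-⊆ S⊆S′ w)

  walk-edges : ∀ {S x y ds} → Walk S x ds y → All (_∈ S) (map edge ds)
  walk-edges stop            = []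
  walk-edges (step d p e∈ w) = e∈ ∷ walk-edges w

  record SimpleWalk (S : Subset m) (x y : Vertex) : Set where
    constructor simple
    field
      {darts}     : List Dart
      walk        : Walk S x darts y
      starts      : Unique (map end darts)
      target∉     : y ∉ˡ map end darts

  suffix : ∀ {S x y z ds} → Walk S x ds y → Unique (map end ds) → y ∉ˡ map end ds →
           z ∈ˡ map end ds → SimpleWalk S z y
  suffix w@(step d refl _ _) u        y∉ (here refl) = simple w u y∉
  suffix (step d _ _ w)      (_ ∷ u)  y∉ (there z∈)  = suffix w u (y∉ ∘ there) z∈

  loop-erase : ∀ {S x y ds} → Walk S x ds y → SimpleWalk S x y
  loop-erase stop = simple stop [] λ ()
  loop-erase {x = x} {y} (step d refl e∈ w) with x ≟ y
  ... | yes refl = simple stop [] λ ()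
  ... | no x≢y with loop-erase w
  ...   | simple {ds} w′ u y∉ with any? (x ≟_) (map end ds)
  ...     | yes x∈ = suffix w′ u y∉ x∈
  ...     | no  x∉ = simple (step d refl e∈ w′) (¬Any⇒All¬ _ x∉ ∷ u)
                       λ { (here y≡x) → x≢y (sym y≡x) ; (there y∈) → y∉ y∈ }

  same-edge : ∀ {d d′} → edge d ≡ edge d′ → end d ≢ end d′ → d′ ≡ opposite d
  same-edge {e , b} {.e , b′} refl ends≢ =
    cong (e ,_) (¬-not λ { refl → ends≢ refl })

  -- A walk that visits no vertex twice can reuse the edge of `d` only as `opposite d`, because its
  -- darts have distinct starts. Walking that dart leads back to `end d`, which is then either the
  -- target or the start of a later dart, and both are excluded.
  simple-edges : ∀ {S x y ds} → Walk S x ds y → Unique (map end ds) → y ∉ˡ map end ds →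
                 Unique (map edge ds)
  simple-edges stop _ _ = []
  simple-edges {y = y} (step {ds = ds} d refl _ w) (x∉ ∷ u) y∉ =
    ¬Any⇒All¬ _ fresh ∷ simple-edges w u (y∉ ∘ there)
    where
    returns : ∀ {v rest} → Walk _ (end (opposite (opposite d))) rest v →
              v ≢ end d → end d ∈ˡ map end rest
    returns {v} stop v≢ = contradiction (cong end (opposite-involutive d)) v≢
    returns (step d₁ p _ _) _ = here (sym (trans p (cong end (opposite-involutive d))))

    -- The rest of the walk starts at `end (opposite d)`. As the starts are distinct, `opposite d`
    -- can only be its first dart.
    second : ∀ {ds} → Walk _ (end (opposite d)) ds y → Unique (map end ds) →
             end d ∉ˡ map end ds → opposite d ∉ˡ ds
    second (step .(opposite d) _ _ w′) _ x∉′ (here refl) =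
      x∉′ (there (returns w′ (y∉ ∘ here)))
    second (step d₀ p _ w′) (a ∷ _) x∉′ (there d′∈) =
      All.lookup a (∈-map⁺ end d′∈) p

    fresh : edge d ∉ˡ map edge ds
    fresh e∈ with ∈-map⁻ edge e∈
    ... | d′ , d′∈ , e≡ = second w u (All¬⇒¬Any x∉)
            (subst (_∈ˡ ds) (same-edge e≡ (All.lookup x∉ (∈-map⁺ end d′∈))) d′∈)

  -- Components as in union-find, each vertex being labelled by a representative. This makes
  -- connectedness in `T - e` decidable. The list `es` is kept apart from `S` so that edges can be
  -- added one at a time while the walks stay in `S`.
  record Labelling (S : Subset m) (es : List Edge) : Set where
    field
      label : Vertex → Vertex
      agree : ∀ {e} → e ∈ˡ es → label (end (e , false)) ≡ label (end (e , true))
      reach : ∀ {x y} → label x ≡ label y → ∃[ ds ] Walk S x ds y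

  labelling : ∀ {S} es → All (_∈ S) es → Labelling S es
  labelling [] [] = record
    { label = λ u → u ; agree = λ () ; reach = λ { refl → [] , stop } }
  labelling {S} (e ∷ es) (e∈ ∷ es∈) = record
    { label = merge ∘ label
    ; agree = λ { (here refl) → trans merge-a (sym merge-b) ; (there e′∈) → cong merge (agree e′∈) }
    ; reach = reach′ }
    where
    open Labelling (labelling es es∈)
    a b : Vertex
    a = label (end (e , false))
    b = label (end (e , true))
    merge : Vertex → Vertex
    merge l = if does (l ≟ a) then b else l
    merge-a : merge a ≡ b
    merge-a rewrite dec-true (a ≟ a) refl = refl
    merge-b : merge b ≡ b
    merge-b with b ≟ a
    ... | yes _ = refl
    ... | no  _ = refl
    -- A walk between the two classes being merged crosses the new edge `e`.
    via : ∀ {x y} → label x ≡ a → label y ≡ b → ∃[ ds ] Walk S x ds y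
    via x≡a y≡b = _ , walk-++ (proj₂ (reach x≡a))
                        (step (e , false) refl e∈ (proj₂ (reach (sym y≡b))))
    reach′ : ∀ {x y} → merge (label x) ≡ merge (label y) → ∃[ ds ] Walk S x ds y
    reach′ {x} {y} eq with label x ≟ a | label y ≟ a
    ... | yes x≡a | yes y≡a = reach (trans x≡a (sym y≡a))
    ... | yes x≡a | no  _   = via x≡a (sym eq)
    ... | no  _   | yes y≡a = walk-reverse (proj₂ (via y≡a eq))
    ... | no  _   | no  _   = reach eq

  edgesOf : (S : Subset m) → List Edge
  edgesOf S = filter (_∈? S) (allFin m)

  components : ∀ S → Labelling S (edgesOf S)
  components S = labelling _ (all-filter (_∈? S) (allFin m))

  module Tree (𝒯 : SpanningTree) where

    T : Subset m
    T = proj₁ 𝒯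

    treeWalk : Connected T
    treeWalk = proj₁ (proj₂ 𝒯)

    private
      component : Edge → Vertex → Vertex
      component e = Labelling.label (components (T - e))

    -- For `e ∈ T` this is the `b` such that `u` lies in the component of `T - e` that contains
    -- `end (e , b)`.
    side : Edge → Vertex → Bool
    side e u = does (component e u ≟ component e (end (e , true)))

    side-agree : ∀ {e} d → edge d ∈ T → edge d ≢ e → side e (end d) ≡ side e (end (opposite d))
    side-agree {e} d d∈T d≢e =
      cong (λ l → does (l ≟ component e (end (e , true))))
        (both d (agree (∈-filter⁺ (_∈? (T - e)) (∈-allFin (edge d)) (x∈p∧x≢y⇒x∈p-y d∈T d≢e))))
      where
      open Labelling (components (T - e))
      both : ∀ d → label (end (edge d , false)) ≡ label (end (edge d , true)) →
             label (end d) ≡ label (end (opposite d))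
      both (_ , false) p = p
      both (_ , true)  p = sym p

    -- If the two ends of `e` had the same label, a simple walk joining them in `T - e` would close
    -- up with `e` to a cycle in `T`.
    side-end : ∀ d → edge d ∈ T → side (edge d) (end d) ≡ proj₂ d
    side-end (e , true)  e∈T = dec-true (component e (end (e , true)) ≟ _) refl
    side-end (e , false) e∈T = dec-false (component e (end (e , false)) ≟ _)
      λ l≡ → cycle (loop-erase (proj₂ (reach (sym l≡))))
      where
      open Labelling (components (T - e))
      cycle : SimpleWalk (T - e) (end (e , true)) (end (e , false)) → ⊥
      cycle (simple w u y∉) =
        proj₂ (proj₂ 𝒯) _ (e , false) _ (step _ refl e∈T (walk-⊆ (p─q⊆p T ⁅ e ⁆) w))
          (All.map (λ { e′∈ refl → x∉p-x T e e′∈ }) (walk-edges w) ∷ simple-edges w u y∉)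
          (¬Any⇒All¬ _ y∉ ∷ u)

-- Iteration of maps, and the tour as an orbit of `advance T`

module _ {A : Set} (f : A → A) where

  iterate-suc : ∀ x k → iterate f (f x) k ≡ f (iterate f x k)
  iterate-suc x zero    = refl
  iterate-suc x (suc k) = iterate-suc (f x) k

  iterate-+ : ∀ x i j → iterate f x (i + j) ≡ iterate f (iterate f x i) j
  iterate-+ x zero    j = refl
  iterate-+ x (suc i) j = iterate-+ (f x) i j

  iterate-inverse : ∀ (g : A → A) → (∀ x → f (g x) ≡ x) →
                    ∀ x k → iterate f (iterate g x k) k ≡ x
  iterate-inverse g fg x zero    = refl
  iterate-inverse g fg x (suc k) = trans
    (cong (λ y → iterate f y k) (fg-iterate x k))
    (iterate-inverse g fg x k)
    where
    fg-iterate : ∀ x k → f (iterate g (g x) k) ≡ iterate g x k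
    fg-iterate x zero    = fg x
    fg-iterate x (suc k) = fg-iterate (g x) k

module Tours (G : RibbonGraph) where
  open Cuts G public

  next-surjective : ∀ x → ∃[ y ] next y ≡ x
  next-surjective x with k , p ← cyclic (next x) x (next-end x) =
    iterate next x k , trans (sym (iterate-suc next x k)) p

  private
    bit : Bool → Fin 2
    bit false = zero
    bit true  = suc zero

    bit-injective : ∀ {b c} → bit b ≡ bit c → b ≡ c
    bit-injective {false} {false} _ = refl
    bit-injective {true}  {true}  _ = refl

    code : Dart → Fin (2 * m)
    code (e , b) = combine (bit b) e

    code-injective : ∀ {d d′} → code d ≡ code d′ → d ≡ d′
    code-injective {e , b} {e′ , b′} p with q , refl ← combine-injective (bit b) e (bit b′) e′ p =
      cong (e ,_) (bit-injective q)

  -- Pigeonhole: the iterates of index `0` to `2 * m` lie among `2 * m` darts.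
  repeats : ∀ (g : Dart → Dart) x →
            ∃₂ λ i j → i < j × j ≤ 2 * m × iterate g x i ≡ iterate g x j
  repeats g x with i , j , i<j , p ← pigeonhole (ℕ.n<1+n (2 * m)) (λ i → code (iterate g x (toℕ i))) =
    toℕ i , toℕ j , i<j , toℕ≤pred[n] j , code-injective p

  module Tour (𝒯 : SpanningTree) where
    open Tree 𝒯 public

    σ : Dart → Dart
    σ = advance T

    σ-∈ : ∀ {d} → edge d ∈ T → σ d ≡ next (opposite d)
    σ-∈ {d} d∈T rewrite dec-true (edge d ∈? T) d∈T = refl

    σ-∉ : ∀ {d} → edge d ∉ T → σ d ≡ next d
    σ-∉ {d} d∉T rewrite dec-false (edge d ∈? T) d∉T = refl

    σ-surjective : ∀ x → ∃[ y ] σ y ≡ x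
    σ-surjective x with y , refl ← next-surjective x with edge y ∈? T
    ... | yes y∈T = opposite y , trans (σ-∈ y∈T) (cong next (opposite-involutive y))
    ... | no  y∉T = y , σ-∉ y∉T

    -- Iterate a section `τ` of the surjection `σ` backwards from `x` until the orbit repeats, at
    -- `i` and `suc i + k`. Applying `σ` `i` times to the repetition gives `x` as the `suc k`-th
    -- iterate of `τ` at `x`, and applying `σ` `suc k` more times closes the cycle.
    recurrent : ∀ x → ∃[ k ] iterate σ (σ x) k ≡ x
    recurrent x with i , j , i<j , _ , p ← repeats (proj₁ ∘ σ-surjective) x
      with k , refl ← m≤n⇒∃[o]m+o≡n i<j = k , (begin
        iterate σ x (suc k)                         ≡⟨ cong (λ y → iterate σ y (suc k)) x≡ ⟩
        iterate σ (iterate τ x (suc k)) (suc k)     ≡⟨ iterate-inverse σ τ στ x (suc k) ⟩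
        x                                           ∎)
      where
      open ≡-Reasoning
      τ : Dart → Dart
      τ = proj₁ ∘ σ-surjective
      στ : ∀ x → σ (τ x) ≡ x
      στ = proj₂ ∘ σ-surjective
      x≡ : x ≡ iterate τ x (suc k)
      x≡ = begin
        x                                               ≡⟨ iterate-inverse σ τ στ x i ⟨
        iterate σ (iterate τ x i) i                     ≡⟨ cong (λ y → iterate σ y i) p ⟩
        iterate σ (iterate τ x (suc i + k)) i           ≡⟨ cong (λ l → iterate σ (iterate τ x (suc l)) i) (+-comm i k) ⟩
        iterate σ (iterate τ x (suc k + i)) i           ≡⟨ cong (λ y → iterate σ y i) (iterate-+ τ x (suc k) i) ⟩
        iterate σ (iterate τ (iterate τ x (suc k)) i) i ≡⟨ iterate-inverse σ τ στ _ i ⟩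
        iterate τ x (suc k)                             ∎

    side-σ : ∀ {e} y → edge y ≢ e → side e (end (σ y)) ≡ side e (end y)
    side-σ {e} y y≢e with edge y ∈? T
    ... | yes y∈T = trans (cong (side e) (next-end (opposite y))) (sym (side-agree y y∈T y≢e))
    ... | no  y∉T = cong (side e) (next-end y)

    side-σ-cross : ∀ x → edge x ∈ T → side (edge x) (end (σ x)) ≡ not (proj₂ x)
    side-σ-cross x x∈T = trans
      (cong (side (edge x)) (trans (cong end (σ-∈ x∈T)) (next-end (opposite x))))
      (side-end (opposite x) x∈T)

    on-side : ∀ {e b} y → e ∈ T → edge y ≡ e → side e (end y) ≡ b → y ≡ (e , b)
    on-side y e∈T refl s = cong (edge y ,_) (trans (sym (side-end y e∈T)) s)

    module _ (P : Dart → Set) (P-σ : ∀ {x} → P x → P (σ x)) where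

      -- After x the orbit is on the far side of T - edge x, which it can only
      -- leave through opposite x; as it comes back to x, it does so.
      reach-opposite : ∀ {x} → edge x ∈ T → P x → P (opposite x)
      reach-opposite {x} x∈T Px with k , p ← recurrent x =
        go k (σ x) (side-σ-cross x x∈T) (P-σ Px) p
        where
        go : ∀ k y → side (edge x) (end y) ≡ not (proj₂ x) → P y → iterate σ y k ≡ x → P (opposite x)
        go k y s Py p with edge y ≟ edge x
        ... | yes y≡x = subst P (on-side y x∈T y≡x s) Py
        go zero    y s Py p | no y≢x = contradiction (cong edge p) y≢x
        go (suc k) y s Py p | no y≢x = go k (σ y) (trans (side-σ y y≢x) s) (P-σ Py) p

      -- At a tree dart, `next x` is `σ (opposite x)`, so that `reach-opposite` reduces rotation
      -- around the vertex to a step of the tour.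
      reach-next : ∀ {x} → P x → P (next x)
      reach-next {x} Px with edge x ∈? T
      ... | no  x∉T = subst P (σ-∉ x∉T) (P-σ Px)
      ... | yes x∈T = subst P (trans (σ-∈ x∈T) (cong next (opposite-involutive x)))
                        (P-σ (reach-opposite x∈T Px))

      reach-at : ∀ {x y} → end x ≡ end y → P x → P y
      reach-at {x} {y} x≡y Px with k , refl ← cyclic x y x≡y = go k Px
        where
        go : ∀ k {x} → P x → P (iterate next x k)
        go zero    Px = Px
        go (suc k) Px = go k (reach-next Px)

      -- This says that `σ` has a single cycle. The property spreads around each vertex by `next`,
      -- and to the other vertices by `opposite` along walks in `T`.
      reach-all : ∀ {x} → P x → ∀ y → P y
      reach-all {x} Px y = along (proj₂ (treeWalk (end x) (end y))) refl Px
        where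
        along : ∀ {u ds x} → Walk T u ds (end y) → end x ≡ u → P x → P y
        along stop             x≡ Px = reach-at x≡ Px
        along (step d p d∈T w) x≡ Px =
          along w refl (reach-opposite d∈T (reach-at (trans x≡ (sym p)) Px))

    orbit : ∀ d y → ∃[ a ] a < 2 * m × iterate σ d a ≡ y
    orbit d = reach-all Visited closed start
      where
      Visited : Dart → Set
      Visited y = ∃[ a ] a < 2 * m × iterate σ d a ≡ y
      start : Visited d
      start with i , j , i<j , j≤ , _ ← repeats σ d = 0 , ≤-<-trans z≤n (<-≤-trans i<j j≤) , refl
      closed : ∀ {x} → Visited x → Visited (σ x)
      closed (a , a< , refl) with m≤n⇒m<n∨m≡n a<
      ... | inj₁ 1+a< = suc a , 1+a< , iterate-suc σ d a
      -- The index `suc a` equals `2 * m` and is out of range. Writing it as `j + r`, the repetition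
      -- allows the smaller index `i + r`.
      ... | inj₂ 1+a≡ with i , j , i<j , j≤ , p ← repeats σ d with r , q ← m≤n⇒∃[o]m+o≡n j≤ =
        i + r , subst (i + r <_) q (+-monoˡ-< r i<j) , (begin
          iterate σ d (i + r)           ≡⟨ iterate-+ σ d i r ⟩
          iterate σ (iterate σ d i) r   ≡⟨ cong (λ y → iterate σ y r) p ⟩
          iterate σ (iterate σ d j) r   ≡⟨ iterate-+ σ d j r ⟨
          iterate σ d (j + r)           ≡⟨ cong (iterate σ d) (trans q (sym 1+a≡)) ⟩
          iterate σ d (suc a)           ≡⟨ iterate-suc σ d a ⟩
          σ (iterate σ d a)             ∎)
        where open ≡-Reasoning

    -- The orbit version of the search in `tour`: it follows `σ` for at most `k` darts and ignores
    -- the pending tree darts. `find-first` shows that both give the same dart.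
    data First (f : Edge) : ℕ → Dart → Dart → Set where
      now   : ∀ {k d} → edge d ≡ f → First f (suc k) d d
      later : ∀ {k d x} → edge d ≢ f → First f k (σ d) x → First f (suc k) d x

    first-edge : ∀ {f k d x} → First f k d x → edge x ≡ f
    first-edge (now d≡f)   = d≡f
    first-edge (later _ F) = first-edge F

    first-unique : ∀ {f k l d x y} → First f k d x → First f l d y → x ≡ y
    first-unique (now _)       (now _)       = refl
    first-unique (now d≡f)     (later d≢f _) = contradiction d≡f d≢f
    first-unique (later d≢f _) (now d≡f)     = contradiction d≡f d≢f
    first-unique (later _ F)   (later _ F′)  = first-unique F F′

    first-exists : ∀ f d → ∃[ x ] First f (2 * m) d x
    first-exists f d with a , a< , p ← orbit d (f , false) = search a< (cong edge p)
      where
      search : ∀ {a k d} → a < k → edge (iterate σ d a) ≡ f → ∃[ x ] First f k d x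
      search {a} {suc k} {d} a< p with edge d ≟ f
      ... | yes d≡f = d , now d≡f
      search {zero}  {suc k} a< p | no d≢f = contradiction p d≢f
      search {suc a} {suc k} a< p | no d≢f with x , F ← search (s≤s⁻¹ a<) p = x , later d≢f F

    -- Once all darts of T have been seen, the tour only turns around the
    -- current vertex, so that every unseen dart starts there. As there are no
    -- loops, these include at most one of the two darts of an edge.
    seen-edge : ∀ (S : Dart → Set) {y} → (∀ {z} → S z → S (σ z) ⊎ σ z ≡ y) →
                (∀ {z} → edge z ∈ T → S z) → ∀ f → ∃[ z ] S z × edge z ≡ f
    seen-edge S {y} S-σ T⊆S f = case (around (f , false)) (around (f , true))
      where
      advanced : ∀ {z} → S z → S (σ z) ⊎ end (σ z) ≡ end y
      advanced Sz with S-σ Sz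
      ... | inj₁ Sσz = inj₁ Sσz
      ... | inj₂ σz≡y = inj₂ (cong end σz≡y)
      closed : ∀ {z} → S z ⊎ end z ≡ end y → S (σ z) ⊎ end (σ z) ≡ end y
      closed (inj₁ Sz) = advanced Sz
      closed {z} (inj₂ z≡y) with edge z ∈? T
      ... | yes z∈T = subst (λ d → S d ⊎ end d ≡ end y) (σ-∈ z∈T) (advanced (T⊆S z∈T))
      ... | no  z∉T = inj₂ (trans (next-end z) z≡y)
      around : ∀ z → S z ⊎ end z ≡ end y
      around = reach-all (λ z → S z ⊎ end z ≡ end y) closed {y} (inj₂ refl)
      case : S (f , false) ⊎ end (f , false) ≡ end y → S (f , true) ⊎ end (f , true) ≡ end y →
             ∃[ z ] S z × edge z ≡ f
      case (inj₁ Sf) _         = _ , Sf , refl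
      case (inj₂ _)  (inj₁ Sf) = _ , Sf , refl
      case (inj₂ p)  (inj₂ q)  = contradiction (trans p (sym q)) (loopless (f , false))

    -- Here `S` is the set of darts already examined and `y` is the current one. The tour cannot
    -- stop before it meets `f`: with nothing pending, all tree darts are in `S`, and `seen-edge`
    -- then puts a dart of `f` in `S`.
    find-tour : ∀ {f k y x} (S : Dart → Set) → (∀ {z} → S z → S (σ z) ⊎ σ z ≡ y) →
                (∀ {z} → S z → edge z ≢ f) → ∀ pending →
                (∀ {z} → edge z ∈ T → z ∈ˡ pending ⊎ S z) →
                First f k y x → find (λ d → edge d ≟ f) (tourFrom k T pending y) ≡ just x
    find-tour {f} {suc k} S S-σ S≢f [] covered F
      with z , Sz , z≡f ← seen-edge S S-σ (λ z∈T → [ (λ ()) , id ]′ (covered z∈T)) f =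
      contradiction z≡f (S≢f Sz)
    find-tour {f} S S-σ S≢f (p ∷ ps) covered (now {d = d} d≡f)
      rewrite dec-true (edge d ≟ f) d≡f = refl
    find-tour {f} {suc k} S S-σ S≢f (p ∷ ps) covered (later {d = y} y≢f F)
      rewrite dec-false (edge y ≟ f) y≢f =
      find-tour (λ z → S z ⊎ z ≡ y) closed unseen _ covered′ F
      where
      closed : ∀ {z} → S z ⊎ z ≡ y → (S (σ z) ⊎ σ z ≡ y) ⊎ σ z ≡ σ y
      closed (inj₁ Sz)   = inj₁ (S-σ Sz)
      closed (inj₂ refl) = inj₂ refl
      unseen : ∀ {z} → S z ⊎ z ≡ y → edge z ≢ f
      unseen (inj₁ Sz)   = S≢f Sz
      unseen (inj₂ refl) = y≢f
      covered′ : ∀ {z} → edge z ∈ T → z ∈ˡ filter (λ d → ¬? (d ≟ᵈ y)) (p ∷ ps) ⊎ (S z ⊎ z ≡ y)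
      covered′ {z} z∈T with z ≟ᵈ y | covered z∈T
      ... | yes z≡y | _         = inj₂ (inj₂ z≡y)
      ... | no  z≢y | inj₁ z∈ps = inj₁ (∈-filter⁺ (λ d → ¬? (d ≟ᵈ y)) z∈ps z≢y)
      ... | no  _   | inj₂ Sz   = inj₂ (inj₁ Sz)

    find-first : ∀ {f d x} → First f (2 * m) d x → find (λ d′ → edge d′ ≟ f) (tour T d) ≡ just x
    find-first = find-tour (λ _ → ⊥) ⊥-elim ⊥-elim (treeDarts T) λ {z} z∈T →
      inj₁ (∈-filter⁺ (λ d → edge d ∈? T) (∈-cartesianProduct⁺ (∈-allFin (proj₁ z)) (bool z)) z∈T)
      where
      bool : ∀ (z : Dart) → proj₂ z ∈ˡ false ∷ true ∷ []
      bool (_ , false) = here refl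
      bool (_ , true)  = there (here refl)

-- Finite sums, and the effect on `β` of rotating the starting dart

sum-cong : ∀ {k} {a b : Fin k → ℤ} → a ≗ b → sum a ≡ sum b
sum-cong = sum-cong-≗ +-0-commutativeMonoid

sum-+ : ∀ {k} (a b : Fin k → ℤ) → sum (λ i → a i ℤ.+ b i) ≡ sum a ℤ.+ sum b
sum-+ = ∑-distrib-+ +-0-commutativeMonoid

sum-- : ∀ {k} (a b : Fin k → ℤ) → sum (λ i → a i ℤ.- b i) ≡ sum a ℤ.- sum b
sum-- {zero}  a b = refl
sum-- {suc k} a b = trans
  (cong (λ s → (a zero ℤ.- b zero) ℤ.+ s) (sum-- (a ∘ suc) (b ∘ suc)))
  (lemma (a zero) (b zero) (sum (a ∘ suc)) (sum (b ∘ suc)))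
  where
  lemma : ∀ p q r s → (p ℤ.- q) ℤ.+ (r ℤ.- s) ≡ (p ℤ.+ r) ℤ.- (q ℤ.+ s)
  lemma = solve-∀

sum-0 : ∀ k → sum {k} (λ _ → 0ℤ) ≡ 0ℤ
sum-0 = sum-replicate-zero +-0-commutativeMonoid

sum-single : ∀ {k} (j : Fin k) c → sum (λ i → if does (i ≟ j) then c else 0ℤ) ≡ c
sum-single {suc k} zero    c = trans (cong (λ s → c ℤ.+ s) (sum-0 k)) (ℤ.+-identityʳ c)
sum-single {suc k} (suc j) c = trans (ℤ.+-identityˡ _) (sum-single j c)

module Shifts (G : RibbonGraph) where
  open Tours G public

  opposite-≢ : ∀ d → opposite d ≢ d
  opposite-≢ d p = loopless d (cong end (sym p))

  either-dart : ∀ x y → edge x ≡ edge y → x ≡ y ⊎ x ≡ opposite y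
  either-dart (e , b) (.e , b′) refl with b ≟ᵇ b′
  ... | yes refl = inj₁ refl
  ... | no  b≢b′ = inj₂ (cong (e ,_) (¬-not b≢b′))

  -- Up to `∼`, the change of `β` when the start moves from `d` to `next d`. No tree occurs in it.
  rotation : Dart → Divisor
  rotation d u = ⟦ end (opposite d) ⟧ u ℤ.- ⟦ end d ⟧ u

  module _ (u : Vertex) where

    laplacian : (Vertex → ℤ) → Edge → ℤ
    laplacian φ f = difference φ u (f , false) ℤ.+ difference φ u (f , true)

    laplacian-flat : ∀ φ f → φ (end (f , false)) ≡ φ (end (f , true)) → laplacian φ f ≡ 0ℤ
    laplacian-flat φ f p rewrite p = lemma (⟦ end (f , false) ⟧ u) (⟦ end (f , true) ⟧ u) (φ (end (f , true)))
      where
      lemma : ∀ a b p → a ℤ.* (p ℤ.- p) ℤ.+ b ℤ.* (p ℤ.- p) ≡ 0ℤ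
      lemma = solve-∀

    laplacian-step : ∀ φ d → φ (end d) ≡ 1ℤ → φ (end (opposite d)) ≡ 0ℤ →
                     laplacian φ (edge d) ≡ ⟦ end d ⟧ u ℤ.- ⟦ end (opposite d) ⟧ u
    laplacian-step φ (f , false) p q rewrite p | q = lemma (⟦ end (f , false) ⟧ u) (⟦ end (f , true) ⟧ u)
      where
      lemma : ∀ a b → a ℤ.* 1ℤ ℤ.+ b ℤ.* -1ℤ ≡ a ℤ.- b
      lemma = solve-∀
    laplacian-step φ (f , true) p q rewrite p | q = lemma (⟦ end (f , false) ⟧ u) (⟦ end (f , true) ⟧ u)
      where
      lemma : ∀ a b → a ℤ.* -1ℤ ℤ.+ b ℤ.* 1ℤ ≡ b ℤ.- a
      lemma = solve-∀

    -- The summand `0ℤ` is the rotation term at an edge other than that of the starting dart.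
    unmoved : ∀ {x y} → y ≡ x → ⟦ end y ⟧ u ℤ.- (⟦ end x ⟧ u ℤ.+ 0ℤ) ≡ 0ℤ
    unmoved {x} refl = lemma (⟦ end x ⟧ u)
      where
      lemma : ∀ a → a ℤ.- (a ℤ.+ 0ℤ) ≡ 0ℤ
      lemma = solve-∀

  module Shift (𝒯 : SpanningTree) where
    open Tour 𝒯 public

    first : Edge → Dart → Dart
    first f d = proj₁ (first-exists f d)

    First-first : ∀ f d → First f (2 * m) d (first f d)
    First-first f d = proj₂ (first-exists f d)

    outside : Edge → ℤ → ℤ
    outside f c = if does (f ∈? T) then 0ℤ else c

    β-first : ∀ d → β d 𝒯 ≗ sumOutside T (λ f → ⟦ end (first f d) ⟧)
    β-first d u = sum-cong λ f → cong (outside f)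
      (cong (λ x → maybe′ ⟦_⟧ (λ _ → 0ℤ) (Maybe.map end x) u) (find-first (First-first f d)))

    β-break : ∀ d → IsBreak (β d 𝒯)
    β-break d = 𝒯 , (λ f → proj₂ (first f d)) , λ u → trans (β-first d u)
      (sum-cong λ f → cong (λ e → outside f (⟦ end (e , proj₂ (first f d)) ⟧ u)) (first-edge (First-first f d)))

    module TreeDart (d : Dart) (d∈T : edge d ∈ T) where

      -- The components of `T - edge d` containing `end d` and `end (opposite d)` respectively.
      Near Far : Vertex → Set
      Near u = side (edge d) u ≡ proj₂ d
      Far  u = side (edge d) u ≡ not (proj₂ d)

      near-or-far : ∀ u → Near u ⊎ Far u
      near-or-far u with side (edge d) u ≟ᵇ proj₂ d
      ... | yes p = inj₁ p
      ... | no  p = inj₂ (¬-not p)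

      near-far : ∀ {u} → Near u → ¬ Far u
      near-far = not-¬

      nearSide : Vertex → ℤ
      nearSide u = if does (side (edge d) u ≟ᵇ proj₂ d) then 1ℤ else 0ℤ

      nearSide-near : ∀ {u} → Near u → nearSide u ≡ 1ℤ
      nearSide-near {u} near = cong (if_then 1ℤ else 0ℤ) (dec-true (side (edge d) u ≟ᵇ proj₂ d) near)

      nearSide-far : ∀ {u} → Far u → nearSide u ≡ 0ℤ
      nearSide-far {u} far =
        cong (if_then 1ℤ else 0ℤ) (dec-false (side (edge d) u ≟ᵇ proj₂ d) λ near → near-far near far)

      -- The stretch of the tour from the arrival across `d` up to and including `opposite d`, by
      -- which it returns.
      data Excursion : Dart → Set where
        depart : Excursion (σ d)
        onward : ∀ {z} → Excursion z → z ≢ opposite d → Excursion (σ z)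

      excursion⇒far : ∀ {z} → Excursion z → Far (end z)
      excursion⇒far depart = side-σ-cross d d∈T
      excursion⇒far (onward {z} E z≢) =
        trans (side-σ z λ z≡d → z≢ (on-side z d∈T z≡d (excursion⇒far E))) (excursion⇒far E)

      -- Starting near or lying on the excursion is preserved by `σ`: the near side is left only
      -- through `d`, where the excursion begins, and the excursion ends only at `opposite d`, which
      -- leads back. Since `σ` has a single cycle, every dart is of one of the two kinds.
      far⇒excursion : ∀ {z} → Far (end z) → Excursion z
      far⇒excursion {z} far = [ (λ near → contradiction far (near-far near)) , id ]′ (everywhere z)
        where
        closed : ∀ {z} → Near (end z) ⊎ Excursion z → Near (end (σ z)) ⊎ Excursion (σ z)
        closed {z} (inj₁ near) with edge z ≟ edge d
        ... | yes z≡d = inj₂ (subst (Excursion ∘ σ) (sym (on-side z d∈T z≡d near)) depart)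
        ... | no  z≢d = inj₁ (trans (side-σ z z≢d) near)
        closed {z} (inj₂ E) with z ≟ᵈ opposite d
        ... | yes refl = inj₁ (trans (side-σ-cross (opposite d) d∈T) (not-involutive (proj₂ d)))
        ... | no  z≢   = inj₂ (onward E z≢)
        everywhere : ∀ z → Near (end z) ⊎ Excursion z
        everywhere = reach-all (λ z → Near (end z) ⊎ Excursion z) closed (inj₁ (side-end d d∈T))

      -- The excursion leads from `σ d` to `z`. Either `f` is not met on the way, and the search
      -- continues from `z`, or `x` belongs to the part already run through and is therefore far.
      first-beyond : ∀ {f k x z} → Far (end z) → First f k (σ d) x →
                     (∃[ l ] First f l z x) ⊎ Far (end x)
      first-beyond far F = go (far⇒excursion far)
        where
        go : ∀ {z} → Excursion z → (∃[ l ] First _ l z _) ⊎ Far (end _)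
        go depart = inj₁ (_ , F)
        go (onward E _) with go E
        ... | inj₁ (_ , now _)     = inj₂ (excursion⇒far E)
        ... | inj₁ (_ , later _ F) = inj₁ (_ , F)
        ... | inj₂ far             = inj₂ far

      -- The excursion passes through `z`, so the search ends at `z` or at an earlier dart of the
      -- excursion.
      first-far : ∀ {k x} z → Far (end z) → First (edge z) k (σ d) x → Far (end x)
      first-far z far F with first-beyond far F
      ... | inj₁ (_ , now _)       = far
      ... | inj₁ (_ , later z≢z _) = contradiction refl z≢z
      ... | inj₂ far′              = far′

    first-σ : ∀ {f k d x} → edge d ≢ f → First f k d x → ∃[ l ] First f l (σ d) x
    first-σ d≢f (now d≡f)   = contradiction d≡f d≢f
    first-σ d≢f (later _ F) = _ , F

    -- A non-tree dart d is last in the tour from next d.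
    first-last : ∀ {k d x} → edge d ∉ T → First (edge d) k (next d) x → x ≡ opposite d
    first-last {k} {d} {x} d∉T F with either-dart x d (first-edge F)
    ... | inj₂ x≡ = x≡
    ... | inj₁ refl = contradiction (everywhere (opposite d)) not-reached
      where
      Before : Dart → Set
      Before z = ∃[ l ] First (edge d) l z d
      from-σ : Before (σ d)
      from-σ = _ , subst (λ z → First _ k z d) (sym (σ-∉ d∉T)) F
      closed : ∀ {z} → Before z → Before (σ z)
      closed (_ , now _)     = from-σ
      closed (_ , later _ F) = _ , F
      everywhere : ∀ z → Before z
      everywhere = reach-all Before closed from-σ
      not-reached : ¬ Before (opposite d)
      not-reached (_ , F) = opposite-≢ d (sym (first-unique F (now {k = 0} refl)))

    module TreeShift (d : Dart) (d∈T : edge d ∈ T) where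

      open TreeDart d d∈T
      module Opposite = TreeDart (opposite d) d∈T

      near⇒far : ∀ {u} → Near u → Opposite.Far u
      near⇒far near = trans near (sym (not-involutive (proj₂ d)))

      far⇒near : ∀ {u} → Opposite.Far u → Near u
      far⇒near far = trans far (not-involutive (proj₂ d))

      module _ {f k l x y} (d≢f : edge d ≢ f)
               (F : First f k (σ d) x) (F′ : First f l (σ (opposite d)) y) where

        -- The tour from `σ d` exhausts the far side before it comes near. If `f` is not met there,
        -- the search goes on past `opposite d`, where the other tour begins.
        firsts-near : Near (end x) → y ≡ x
        firsts-near near with first-beyond (side-end (opposite d) d∈T) F
        ... | inj₁ (_ , G) = first-unique F′ (proj₂ (first-σ d≢f G))
        ... | inj₂ far = contradiction far (near-far near)

        -- The mirror image of `firsts-near`: the tour from `σ (opposite d)` exhausts the near side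
        -- first and then passes `d`.
        firsts-far : Far (end y) → y ≡ x
        firsts-far far with Opposite.first-beyond (near⇒far (side-end d d∈T)) F′
        ... | inj₁ (_ , G) = first-unique (proj₂ (first-σ d≢f G)) F
        ... | inj₂ near = contradiction far (near-far (far⇒near near))

      -- Each tour meets an edge between the components on the side that it runs through first: far
      -- after `d`, near after `opposite d`.
      firsts-across : ∀ {k l x y} z → Near (end z) → Far (end (opposite z)) →
                      First (edge z) k (σ d) x → First (edge z) l (σ (opposite d)) y →
                      x ≡ opposite z × y ≡ z
      firsts-across {x = x} {y} z near far F F′ =
        x≡ (either-dart x z (first-edge F)) , y≡ (either-dart y z (first-edge F′))
        where
        x≡ : x ≡ z ⊎ x ≡ opposite z → x ≡ opposite z
        x≡ (inj₁ refl) = contradiction (first-far (opposite z) far F) (near-far near)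
        x≡ (inj₂ eq)   = eq
        y≡ : y ≡ z ⊎ y ≡ opposite z → y ≡ z
        y≡ (inj₁ eq)   = eq
        y≡ (inj₂ refl) = contradiction far (near-far (far⇒near (Opposite.first-far z (near⇒far near) F′)))

    at-end : ∀ (P : Vertex → Set) {x} z → P (end z) → P (end (opposite z)) → edge x ≡ edge z → P (end x)
    at-end P {x} z Pz Pz′ x≡z with either-dart x z x≡z
    ... | inj₁ refl = Pz
    ... | inj₂ refl = Pz′

    module _ (u : Vertex) where

      -- Charging the whole rotation to the edge of `d` allows a comparison edge by edge. In use,
      -- `x` and `y` are the first darts of `f` in the tours from `d` and from `next d`.
      shifted : Dart → Edge → Dart → Dart → ℤ
      shifted d f x y = outside f (⟦ end y ⟧ u) ℤ.-
        (outside f (⟦ end x ⟧ u) ℤ.+ (if does (f ≟ edge d) then rotation d u else 0ℤ))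

      shifted-∉ : ∀ {d f k l x y} → edge d ∉ T → First f k d x → First f l (next d) y →
                  shifted d f x y ≡ 0ℤ
      shifted-∉ {d} {f} {l = l} {y = y} d∉T F F′ with f ∈? T | f ≟ edge d
      ... | yes f∈T | yes refl = contradiction f∈T d∉T
      ... | yes _   | no  _    = refl
      -- The edge of `d` is cut through at `d` in one tour and at `opposite d` in the other, which
      -- accounts for the rotation.
      ... | no  _   | yes refl
        rewrite first-last d∉T F′ | sym (first-unique (now {k = 0} refl) F) =
        lemma (⟦ end d ⟧ u) (⟦ end (opposite d) ⟧ u)
        where
        lemma : ∀ a b → b ℤ.- (a ℤ.+ (b ℤ.- a)) ≡ 0ℤ
        lemma = solve-∀
      ... | no  _   | no f≢d = unmoved u
        (first-unique (subst (λ z → First f l z y) (sym (σ-∉ d∉T)) F′) (proj₂ (first-σ (f≢d ∘ sym) F)))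

      module _ (d : Dart) (d∈T : edge d ∈ T) where
        open TreeDart d d∈T
        open TreeShift d d∈T

        -- An edge inside a component keeps its chip, and the indicator `nearSide` is constant on
        -- it. On an edge between the components the chip moves from the far end to the near end,
        -- just as the Laplacian of `nearSide` prescribes.
        laplacian-firsts : ∀ {f k l x y} → edge d ≢ f → First f k (σ d) x → First f l (σ (opposite d)) y →
                           ⟦ end y ⟧ u ℤ.- (⟦ end x ⟧ u ℤ.+ 0ℤ) ≡ laplacian u nearSide f
        laplacian-firsts {f} {x = x} {y} d≢f F F′ =
          compare (near-or-far (end (f , false))) (near-or-far (end (f , true)))
          where
          same : y ≡ x → nearSide (end (f , false)) ≡ nearSide (end (f , true)) →
                 ⟦ end y ⟧ u ℤ.- (⟦ end x ⟧ u ℤ.+ 0ℤ) ≡ laplacian u nearSide f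
          same y≡x eq = trans (unmoved u y≡x) (sym (laplacian-flat u nearSide f eq))
          across : ∀ z → x ≡ opposite z × y ≡ z → Near (end z) → Far (end (opposite z)) →
                   ⟦ end y ⟧ u ℤ.- (⟦ end x ⟧ u ℤ.+ 0ℤ) ≡ laplacian u nearSide (edge z)
          across z (refl , refl) near far = trans
            (cong (λ c → ⟦ end z ⟧ u ℤ.- c) (ℤ.+-identityʳ _))
            (sym (laplacian-step u nearSide z (nearSide-near near) (nearSide-far far)))
          compare : Near (end (f , false)) ⊎ Far (end (f , false)) →
                    Near (end (f , true)) ⊎ Far (end (f , true)) →
                    ⟦ end y ⟧ u ℤ.- (⟦ end x ⟧ u ℤ.+ 0ℤ) ≡ laplacian u nearSide f
          compare (inj₁ p) (inj₁ q) = same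
            (firsts-near d≢f F F′ (at-end Near (f , false) p q (first-edge F)))
            (trans (nearSide-near p) (sym (nearSide-near q)))
          compare (inj₂ p) (inj₂ q) = same
            (firsts-far d≢f F F′ (at-end Far (f , false) p q (first-edge F′)))
            (trans (nearSide-far p) (sym (nearSide-far q)))
          compare (inj₁ p) (inj₂ q) = across _ (firsts-across (f , false) p q F F′) p q
          compare (inj₂ p) (inj₁ q) = across _ (firsts-across (f , true) q p F F′) q p

        shifted-∈ : ∀ {f k l x y} → First f k d x → First f l (next d) y →
                    shifted d f x y ≡ laplacian u nearSide f
        shifted-∈ {f} {l = l} {y = y} F F′ = compare (f ∈? T) (f ≟ edge d)
          where
          lemma : ∀ a b → 0ℤ ℤ.- (0ℤ ℤ.+ (b ℤ.- a)) ≡ a ℤ.- b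
          lemma = solve-∀
          compare : (f∈? : Dec (f ∈ T)) (f≟ : Dec (f ≡ edge d)) →
                    (if does f∈? then 0ℤ else _) ℤ.-
                    ((if does f∈? then 0ℤ else _) ℤ.+ (if does f≟ then rotation d u else 0ℤ)) ≡
                    laplacian u nearSide f
          -- The tree edge of `d` carries no chip but crosses the cut. Its Laplacian term is
          -- cancelled by the rotation.
          compare (yes _) (yes refl) = trans (lemma (⟦ end d ⟧ u) (⟦ end (opposite d) ⟧ u))
            (sym (laplacian-step u nearSide d
              (nearSide-near (side-end d d∈T)) (nearSide-far (side-end (opposite d) d∈T))))
          compare (yes f∈T) (no f≢d) = sym (laplacian-flat u nearSide f
            (cong (λ s → if does (s ≟ᵇ proj₂ d) then 1ℤ else 0ℤ) (side-agree (f , false) f∈T f≢d)))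
          compare (no f∉T) (yes refl) = contradiction d∈T f∉T
          compare (no f∉T) (no  f≢d)  = laplacian-firsts (f≢d ∘ sym) (proj₂ (first-σ (f≢d ∘ sym) F))
            (subst (λ z → First f l z y) (sym (trans (σ-∈ d∈T) (cong next (opposite-involutive d)))) F′)

    -- The tree enters only through the potential, which is `nearSide` if the edge of `d` is in `T`
    -- and zero otherwise.
    β-next : ∀ d → β (next d) 𝒯 ∼ (λ u → β d 𝒯 u ℤ.+ rotation d u)
    β-next d = let φ , p = potential in φ , λ u → trans (collect u) (sum-cong (p u))
      where
      term : Vertex → Edge → ℤ
      term u f = shifted u d f (first f d) (first f (next d))
      potential : ∃[ φ ] ∀ u f → term u f ≡ laplacian u φ f
      potential with edge d ∈? T
      ... | yes d∈T = TreeDart.nearSide d d∈T , λ u f →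
        shifted-∈ u d d∈T (First-first f d) (First-first f (next d))
      ... | no  d∉T = (λ _ → 0ℤ) , λ u f → trans
        (shifted-∉ u d∉T (First-first f d) (First-first f (next d)))
        (sym (laplacian-flat u (λ _ → 0ℤ) f refl))
      collect : ∀ u → β (next d) 𝒯 u ℤ.- (β d 𝒯 u ℤ.+ rotation d u) ≡ sum (term u)
      collect u = begin
        β (next d) 𝒯 u ℤ.- (β d 𝒯 u ℤ.+ rotation d u)
          ≡⟨ cong₂ ℤ._-_ (β-first (next d) u)
               (cong₂ ℤ._+_ (β-first d u) (sym (sum-single (edge d) (rotation d u)))) ⟩
        sum after ℤ.- (sum before ℤ.+ sum change)
          ≡⟨ cong (λ c → sum after ℤ.- c) (sum-+ before change) ⟨
        sum after ℤ.- sum (λ f → before f ℤ.+ change f)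
          ≡⟨ sum-- after (λ f → before f ℤ.+ change f) ⟨
        sum (term u) ∎
        where
        open ≡-Reasoning
        after before change : Edge → ℤ
        after  f = outside f (⟦ end (first f (next d)) ⟧ u)
        before f = outside f (⟦ end (first f d) ⟧ u)
        change f = if does (f ≟ edge d) then rotation d u else 0ℤ

-- Inequalities for integers and for the energy of one edge

sum-nonneg : ∀ {k} (a : Fin k → ℤ) → (∀ i → 0ℤ ℤ.≤ a i) → 0ℤ ℤ.≤ sum a
sum-nonneg {zero}  a 0≤a = ℤ.≤-refl
sum-nonneg {suc k} a 0≤a = ℤ.+-mono-≤ (0≤a zero) (sum-nonneg (a ∘ suc) (0≤a ∘ suc))

sum-zero : ∀ {k} (a : Fin k → ℤ) → (∀ i → 0ℤ ℤ.≤ a i) → sum a ≡ 0ℤ → ∀ i → a i ≡ 0ℤ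
sum-zero {suc k} a 0≤a Σ≡0 = λ where
    zero    → head≡0
    (suc i) → sum-zero (a ∘ suc) (0≤a ∘ suc) tail≡0 i
  where
  head≡0 : a zero ≡ 0ℤ
  head≡0 = ℤ.≤-antisym (subst₂ ℤ._≤_ (ℤ.+-identityʳ (a zero)) Σ≡0
             (ℤ.+-monoʳ-≤ (a zero) (sum-nonneg (a ∘ suc) (0≤a ∘ suc)))) (0≤a zero)
  tail≡0 : sum (a ∘ suc) ≡ 0ℤ
  tail≡0 = trans (sym (ℤ.+-identityˡ _)) (trans (cong (λ c → c ℤ.+ sum (a ∘ suc)) (sym head≡0)) Σ≡0)

0≤i*i : ∀ i → 0ℤ ℤ.≤ i ℤ.* i
0≤i*i (ℤ.+ zero)  = +≤+ z≤n
0≤i*i (ℤ.+ suc n) = +≤+ z≤n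
0≤i*i ℤ.-[1+ n ]  = +≤+ z≤n

i≤i*i : ∀ i → i ℤ.≤ i ℤ.* i
i≤i*i (ℤ.+ zero)  = +≤+ z≤n
i≤i*i (ℤ.+ suc n) = +≤+ (ℕ.m≤m*n (suc n) (suc n))
i≤i*i ℤ.-[1+ n ]  = -≤+

module _ (g : Bool → ℤ) where

  -- The values of `g` stand for those of a potential at the two ends of an edge.
  energy : ℤ
  energy = (g false ℤ.- g true) ℤ.* (g false ℤ.- g true)

  energy-sym : energy ≡ (g true ℤ.- g false) ℤ.* (g true ℤ.- g false)
  energy-sym = lemma (g false) (g true)
    where
    lemma : ∀ p q → (p ℤ.- q) ℤ.* (p ℤ.- q) ≡ (q ℤ.- p) ℤ.* (q ℤ.- p)
    lemma = solve-∀

  -- The drop is zero or, up to sign, the difference that is squared, and an integer is at most its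
  -- square.
  drop≤energy : ∀ b c → g b ℤ.- g c ℤ.≤ energy
  drop≤energy false false = subst (ℤ._≤ energy) (sym (ℤ.+-inverseʳ (g false))) (0≤i*i (g false ℤ.- g true))
  drop≤energy true  true  = subst (ℤ._≤ energy) (sym (ℤ.+-inverseʳ (g true))) (0≤i*i (g false ℤ.- g true))
  drop≤energy false true  = i≤i*i _
  drop≤energy true  false = subst (g true ℤ.- g false ℤ.≤_) (sym energy-sym) (i≤i*i _)

  private
    flat : energy ≡ 0ℤ → g false ≡ g true
    flat e≡0 = ℤ.i-j≡0⇒i≡j _ _ ([ id , id ]′ (ℤ.i*j≡0⇒i≡0∨j≡0 (g false ℤ.- g true) e≡0))

    drop-≤ : ∀ {b c} → energy ≡ g b ℤ.- g c → g c ℤ.≤ g b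
    drop-≤ e≡ = ℤ.0≤i-j⇒j≤i (subst (0ℤ ℤ.≤_) e≡ (0≤i*i (g false ℤ.- g true)))

  -- In use, `b` and `c` are the heads of an edge in two orientations. If they coincide, the energy
  -- vanishes and `g` is constant; otherwise the drop from `b` to `c` is a square, hence
  -- nonnegative.
  tight : ∀ b c → energy ≡ g b ℤ.- g c → g (not b) ℤ.≤ g b × g c ℤ.≤ g (not c)
  tight false false e≡ with eq ← flat (trans e≡ (ℤ.+-inverseʳ (g false))) =
    ℤ.≤-reflexive (sym eq) , ℤ.≤-reflexive eq
  tight true  true  e≡ with eq ← flat (trans e≡ (ℤ.+-inverseʳ (g true))) =
    ℤ.≤-reflexive eq , ℤ.≤-reflexive (sym eq)
  tight false true  e≡ = drop-≤ e≡ , drop-≤ e≡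
  tight true  false e≡ = drop-≤ e≡ , drop-≤ e≡

-- Rooted orientations and the uniqueness of break divisors

module Breaks (G : RibbonGraph) where
  open Shifts G public

  module Rooted (𝒯 : SpanningTree) (q : Vertex) where
    open Tree 𝒯

    child : Edge → Vertex
    child e = end (e , not (side e q))

    parent : Edge → Vertex
    parent e = end (e , side e q)

    -- Reachability from `q`, phrased as an induction principle. Along a simple walk from `q`, every
    -- edge still ahead has the current vertex on the side of `q`, so it is walked from parent to
    -- child.
    from-root : ∀ (R : Vertex → Vertex → Set) → (∀ {x} → R x x) → (∀ {x y z} → R x y → R y z → R x z) →
                (∀ {e} → e ∈ T → R (parent e) (child e)) → ∀ u → R q u
    from-root R R-refl R-trans R-edge u with simple w starts u∉ ← loop-erase (proj₂ (treeWalk q u)) =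
      go w (simple-edges w starts u∉) (All.tabulate λ _ → refl) R-refl
      where
      go : ∀ {x ds} → Walk T x ds u → Unique (map edge ds) →
           All (λ e → side e x ≡ side e q) (map edge ds) → R q x → R q u
      go stop _ _ Rqu = Rqu
      go (step d refl d∈T w) (d∉ ∷ us) (s ∷ ss) Rqx =
        go w us
          (All.zipWith (λ (d≢e , s′) → trans (sym (side-agree d d∈T d≢e)) s′) (d∉ , ss))
          (R-trans Rqx (subst (λ b → R (end (edge d , b)) (end (edge d , not b)))
            (trans (sym s) (side-end d d∈T)) (R-edge d∈T)))

    side-child : ∀ {e} → e ∈ T → side e q ≢ side e (child e)
    side-child {e} e∈T p = not-¬ {side e q} refl (trans p (side-end (e , not (side e q)) e∈T))

    -- The dart by which the walk first reaches `u`. The edges walked before it avoid `u`, so among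
    -- the edges at `u` only that of this dart has `x` and `u` on different sides.
    arrival : ∀ {x u ds} → Walk T x ds u → x ≢ u → Σ[ d ∈ Dart ]
              edge d ∈ T × end (opposite d) ≡ u × side (edge d) x ≡ side (edge d) (end d) ×
              (∀ e b → end (e , b) ≡ u → e ≢ edge d → side e x ≡ side e u)
    arrival stop x≢x = contradiction refl x≢x
    arrival {u = u} (step d refl d∈T w) x≢u with end (opposite d) ≟ u
    ... | yes refl = d , d∈T , refl , refl , λ e b _ e≢d → side-agree d d∈T (e≢d ∘ sym)
    ... | no  z≢u with d′ , d′∈T , refl , s , ss ← arrival w z≢u =
      d′ , d′∈T , refl , trans (side-agree d d∈T (away (opposite d′) refl)) s ,
      λ e b e≡u e≢d′ → trans (side-agree d d∈T (away (e , b) e≡u)) (ss e b e≡u e≢d′)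
      where
      away : ∀ y → end y ≡ u → edge d ≢ edge y
      away y y≡u d≡y with either-dart y d (sym d≡y)
      ... | inj₁ refl = x≢u y≡u
      ... | inj₂ refl = z≢u y≡u

    childAt : Vertex → Edge → ℤ
    childAt u e = if does (e ∈? T) then ⟦ child e ⟧ u else 0ℤ

    -- A vertex other than `q` is the child of exactly one tree edge, that of its `arrival` dart.
    -- The root is the child of none, since a child is never on the side of `q`.
    children : ∀ u → sum (childAt u) ≡ 1ℤ ℤ.- ⟦ q ⟧ u
    children u with u ≟ q
    ... | yes refl = trans (sum-cong none) (sum-0 m)
      where
      none : ∀ e → childAt q e ≡ 0ℤ
      none e with e ∈? T
      ... | no  _   = refl
      ... | yes e∈T = cong (if_then 1ℤ else 0ℤ)
              (dec-false (q ≟ child e) (λ p → side-child e∈T (cong (side e) p)))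
    ... | no  u≢q with d , d∈T , d≡u , s , ss ← arrival (proj₂ (treeWalk q u)) (u≢q ∘ sym) =
      trans (sum-cong one) (sum-single (edge d) 1ℤ)
      where
      child-d : child (edge d) ≡ u
      child-d = trans (cong (λ b → end (edge d , not b)) (trans s (side-end d d∈T))) d≡u
      one : ∀ e → childAt u e ≡ (if does (e ≟ edge d) then 1ℤ else 0ℤ)
      one e with e ∈? T | e ≟ edge d
      ... | yes _   | yes refl = cong (if_then 1ℤ else 0ℤ) (dec-true (u ≟ child (edge d)) (sym child-d))
      ... | no  e∉T | yes refl = contradiction d∈T e∉T
      ... | no  _   | no  _    = refl
      ... | yes e∈T | no  e≢d  = cong (if_then 1ℤ else 0ℤ) (dec-false (u ≟ child e) λ p →
              side-child e∈T (trans (ss e _ (sym p) e≢d) (cong (side e) p)))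

  indegree : (Edge → Bool) → Divisor
  indegree o u = sum λ e → ⟦ end (e , o e) ⟧ u

  record RootedOrientation (q : Vertex) (D : Divisor) : Set₁ where
    field
      head      : Edge → Bool
      indegree≡ : ∀ u → indegree head u ≡ D u ℤ.+ (1ℤ ℤ.- ⟦ q ⟧ u)
      from-root : ∀ (R : Vertex → Vertex → Set) → (∀ {x} → R x x) → (∀ {x y z} → R x y → R y z → R x z) →
                  (∀ e → R (end (e , not (head e))) (end (e , head e))) → ∀ u → R q u

  -- Orient the tree edges away from q and every other edge towards its chip.
  orientation : ∀ q {D} → IsBreak D → RootedOrientation q D
  orientation q {D} (𝒯 , chip , D≗) = record
    { head = head ; indegree≡ = indegree≡
    ; from-root = λ R R-refl R-trans R-edge → from-root R R-refl R-trans λ {e} e∈T →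
        subst (λ b → R (end (e , b)) (child e)) (not-involutive _)
          (subst (λ b → R (end (e , not b)) (end (e , b)))
            (cong (if_then not (side e q) else chip e) (dec-true (e ∈? T) e∈T)) (R-edge e)) }
    where
    open Tree 𝒯
    open Rooted 𝒯 q
    head : Edge → Bool
    head e = if does (e ∈? T) then not (side e q) else chip e
    indegree≡ : ∀ u → indegree head u ≡ D u ℤ.+ (1ℤ ℤ.- ⟦ q ⟧ u)
    indegree≡ u = begin
      indegree head u
        ≡⟨ sum-cong split ⟩
      sum (λ e → chipAt e ℤ.+ childAt u e)
        ≡⟨ sum-+ chipAt (childAt u) ⟩
      sum chipAt ℤ.+ sum (childAt u)
        ≡⟨ cong₂ ℤ._+_ (sym (D≗ u)) (children u) ⟩
      D u ℤ.+ (1ℤ ℤ.- ⟦ q ⟧ u) ∎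
      where
      open ≡-Reasoning
      chipAt : Edge → ℤ
      chipAt e = if does (e ∈? T) then 0ℤ else ⟦ end (e , chip e) ⟧ u
      split : ∀ e → ⟦ end (e , head e) ⟧ u ≡ chipAt e ℤ.+ childAt u e
      split e with does (e ∈? T)
      ... | true  = sym (ℤ.+-identityˡ _)
      ... | false = sym (ℤ.+-identityʳ _)

  pairing : (Vertex → ℤ) → Divisor → ℤ
  pairing φ D = sum λ u → φ u ℤ.* D u

  pairing-sum : ∀ φ (D : Edge → Divisor) →
                pairing φ (λ u → sum λ e → D e u) ≡ sum λ e → pairing φ (D e)
  pairing-sum φ D = trans
    (sum-cong λ u → *-distribˡ-sum +-*-semiring {m} (φ u) (λ e → D e u))
    (∑-comm +-0-commutativeMonoid {n} {m} λ u e → φ u ℤ.* D e u)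

  pairing-+ : ∀ φ D D′ → pairing φ (λ u → D u ℤ.+ D′ u) ≡ pairing φ D ℤ.+ pairing φ D′
  pairing-+ φ D D′ = trans (sum-cong λ u → ℤ.*-distribˡ-+ (φ u) (D u) (D′ u))
    (sum-+ (λ u → φ u ℤ.* D u) (λ u → φ u ℤ.* D′ u))

  pairing-point : ∀ φ v c → pairing φ (λ u → ⟦ v ⟧ u ℤ.* c) ≡ φ v ℤ.* c
  pairing-point φ v c = trans (sum-cong at) (sum-single v (φ v ℤ.* c))
    where
    at : ∀ u → φ u ℤ.* (⟦ v ⟧ u ℤ.* c) ≡ (if does (u ≟ v) then φ v ℤ.* c else 0ℤ)
    at u with u ≟ v
    ... | yes refl = cong (φ u ℤ.*_) (ℤ.*-identityˡ c)
    ... | no  _    = trans (cong (φ u ℤ.*_) (ℤ.*-zeroˡ c)) (ℤ.*-zeroʳ (φ u))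

  along : (Vertex → ℤ) → Edge → Bool → ℤ
  along φ e b = φ (end (e , b))

  -- Summation by parts: the quadratic form of the Laplacian is the Dirichlet energy.
  pairing-Δ : ∀ φ → pairing φ (Δ φ) ≡ sum λ e → energy (along φ e)
  pairing-Δ φ = trans (pairing-sum φ λ e u → difference φ u (e , false) ℤ.+ difference φ u (e , true))
    (sum-cong λ e → trans
      (pairing-+ φ (λ u → difference φ u (e , false)) (λ u → difference φ u (e , true)))
      (trans (cong₂ ℤ._+_ (pairing-point φ (end (e , false)) _) (pairing-point φ (end (e , true)) _))
             (lemma (along φ e false) (along φ e true))))
    where
    lemma : ∀ p q → p ℤ.* (p ℤ.- q) ℤ.+ q ℤ.* (q ℤ.- p) ≡ (p ℤ.- q) ℤ.* (p ℤ.- q)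
    lemma = solve-∀

  pairing-indegree : ∀ φ o → pairing φ (indegree o) ≡ sum λ e → along φ e (o e)
  pairing-indegree φ o = trans (pairing-sum φ λ e → ⟦ end (e , o e) ⟧)
    (sum-cong λ e → trans
      (sum-cong λ u → cong (φ u ℤ.*_) (sym (ℤ.*-identityʳ (⟦ end (e , o e) ⟧ u))))
      (trans (pairing-point φ (end (e , o e)) 1ℤ) (ℤ.*-identityʳ _)))

  Δ-flat : ∀ φ → (∀ x y → φ x ≡ φ y) → ∀ u → Δ φ u ≡ 0ℤ
  Δ-flat φ flat u = trans (sum-cong λ e → laplacian-flat u φ e (flat _ _)) (sum-0 m)

  break-unique : ∀ {D D′} → IsBreak D → IsBreak D′ → D ∼ D′ → D ≗ D′
  break-unique {D} {D′} B B′ (φ , D-D′) q =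
    ℤ.i-j≡0⇒i≡j _ _ (trans (D-D′ q) (Δ-flat φ (λ x y → trans (constant x) (sym (constant y))) q))
    where
    -- The vertex at which the two divisors are compared serves as the root of both orientations.
    module O  = RootedOrientation (orientation q {D} B)
    module O′ = RootedOrientation (orientation q {D′} B′)
    -- Nonnegative on each edge by `drop≤energy` and of total zero, hence zero on each edge; this is
    -- the equality that `tight` exploits.
    excess : Edge → ℤ
    excess e = energy (along φ e) ℤ.- (along φ e (O.head e) ℤ.- along φ e (O′.head e))
    balance : ∀ u → indegree O.head u ≡ indegree O′.head u ℤ.+ Δ φ u
    balance u rewrite O.indegree≡ u | O′.indegree≡ u | sym (D-D′ u) = lemma (D u) (D′ u) (1ℤ ℤ.- ⟦ q ⟧ u)
      where
      lemma : ∀ a b c → a ℤ.+ c ≡ (b ℤ.+ c) ℤ.+ (a ℤ.- b)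
      lemma = solve-∀
    heads heads′ energies : ℤ
    heads    = sum λ e → along φ e (O.head e)
    heads′   = sum λ e → along φ e (O′.head e)
    energies = sum λ e → energy (along φ e)
    heads≡ : heads ≡ heads′ ℤ.+ energies
    heads≡ = begin
      heads
        ≡⟨ pairing-indegree φ O.head ⟨
      pairing φ (indegree O.head)
        ≡⟨ sum-cong (λ u → cong (φ u ℤ.*_) (balance u)) ⟩
      pairing φ (λ u → indegree O′.head u ℤ.+ Δ φ u)
        ≡⟨ pairing-+ φ (indegree O′.head) (Δ φ) ⟩
      pairing φ (indegree O′.head) ℤ.+ pairing φ (Δ φ)
        ≡⟨ cong₂ ℤ._+_ (pairing-indegree φ O′.head) (pairing-Δ φ) ⟩
      heads′ ℤ.+ energies ∎
      where open ≡-Reasoning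
    total : sum excess ≡ 0ℤ
    total = begin
      sum excess
        ≡⟨ sum-- (λ e → energy (along φ e)) (λ e → along φ e (O.head e) ℤ.- along φ e (O′.head e)) ⟩
      energies ℤ.- sum (λ e → along φ e (O.head e) ℤ.- along φ e (O′.head e))
        ≡⟨ cong (λ c → energies ℤ.- c) (sum-- (λ e → along φ e (O.head e)) (λ e → along φ e (O′.head e))) ⟩
      energies ℤ.- (heads ℤ.- heads′)
        ≡⟨ cong (λ c → energies ℤ.- (c ℤ.- heads′)) heads≡ ⟩
      energies ℤ.- ((heads′ ℤ.+ energies) ℤ.- heads′)
        ≡⟨ lemma energies heads′ ⟩
      0ℤ ∎
      where
      open ≡-Reasoning
      lemma : ∀ a b → a ℤ.- ((b ℤ.+ a) ℤ.- b) ≡ 0ℤ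
      lemma = solve-∀
    tight-at : ∀ e → along φ e (not (O.head e)) ℤ.≤ along φ e (O.head e) ×
                     along φ e (O′.head e) ℤ.≤ along φ e (not (O′.head e))
    tight-at e = tight (along φ e) (O.head e) (O′.head e) (ℤ.i-j≡0⇒i≡j _ _
      (sum-zero excess (λ e → ℤ.i≤j⇒0≤j-i (drop≤energy (along φ e) (O.head e) (O′.head e))) total e))
    constant : ∀ u → φ u ≡ φ q
    constant u = ℤ.≤-antisym
      (O′.from-root (λ x y → φ y ℤ.≤ φ x) ℤ.≤-refl (λ p q → ℤ.≤-trans q p) (proj₂ ∘ tight-at) u)
      (O.from-root (λ x y → φ x ℤ.≤ φ y) ℤ.≤-refl ℤ.≤-trans (proj₁ ∘ tight-at) u)

  -- Composition of rotations, and independence of the action from the starting edge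

  infixl 21 _⊕_
  _⊕_ : Divisor → Divisor → Divisor
  (D ⊕ E) u = D u ℤ.+ E u

  ≗⇒∼ : ∀ {D D′} → D ≗ D′ → D ∼ D′
  ≗⇒∼ {D} {D′} D≗D′ = (λ _ → 0ℤ) , λ u → trans (ℤ.i≡j⇒i-j≡0 (D≗D′ u)) (sym (Δ-flat (λ _ → 0ℤ) (λ _ _ → refl) u))

  ∼-⊕ : ∀ {D D′} E → D ∼ D′ → D ⊕ E ∼ D′ ⊕ E
  ∼-⊕ {D} {D′} E (φ , p) = φ , λ u → trans (lemma (D u) (D′ u) (E u)) (p u)
    where
    lemma : ∀ a b c → (a ℤ.+ c) ℤ.- (b ℤ.+ c) ≡ a ℤ.- b
    lemma = solve-∀

  degree-⟦⟧ : ∀ v → degree ⟦ v ⟧ ≡ 1ℤ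
  degree-⟦⟧ v = sum-single v 1ℤ

  degree-rotation : ∀ d → degree (rotation d) ≡ 0ℤ
  degree-rotation d = trans (sum-- ⟦ end (opposite d) ⟧ ⟦ end d ⟧)
    (cong₂ ℤ._-_ (degree-⟦⟧ (end (opposite d))) (degree-⟦⟧ (end d)))

  rotations : ℕ → Dart → Pic⁰
  rotations zero    d = (λ _ → 0ℤ) , sum-0 n
  rotations (suc k) d = let γ , deg = rotations k (next d) in
    rotation d ⊕ γ , trans (sum-+ (rotation d) γ) (cong₂ ℤ._+_ (degree-rotation d) deg)

  β-iterate : ∀ k d 𝒯 → β (iterate next d k) 𝒯 ∼ β d 𝒯 ⊕ proj₁ (rotations k d)
  β-iterate zero    d 𝒯 = ≗⇒∼ λ u → sym (ℤ.+-identityʳ (β d 𝒯 u))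
  β-iterate (suc k) d 𝒯 =
    ∼-trans {β (iterate next (next d) k) 𝒯} {β (next d) 𝒯 ⊕ γ} {β d 𝒯 ⊕ (rotation d ⊕ γ)}
      (β-iterate k (next d) 𝒯)
      (∼-trans {β (next d) 𝒯 ⊕ γ} {β d 𝒯 ⊕ rotation d ⊕ γ} {β d 𝒯 ⊕ (rotation d ⊕ γ)}
        (∼-⊕ {β (next d) 𝒯} {β d 𝒯 ⊕ rotation d} γ (Shift.β-next 𝒯 d))
        (≗⇒∼ λ u → ℤ.+-assoc (β d 𝒯 u) (rotation d u) (γ u)))
    where
    γ : Divisor
    γ = proj₁ (rotations k (next d))

  -- The number of rotations from `d₁` to `d₂` is fixed before any tree is given, so one class
  -- serves all trees.
  β-change : ∀ d₁ d₂ → end d₁ ≡ end d₂ → Σ[ γ ∈ Pic⁰ ] ∀ 𝒯 → β d₂ 𝒯 ∼ β d₁ 𝒯 ⊕ proj₁ γ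
  β-change d₁ d₂ p with k , refl ← cyclic d₁ d₂ p = rotations k d₁ , β-iterate k d₁

  -- Values of `β` are break divisors, and `break-unique` supplies uniqueness, so linear equivalence
  -- decides the action.
  β-action : ∀ γ d d′ {𝒯 𝒯′} → β d′ 𝒯′ ∼ β d 𝒯 ⊕ proj₁ γ → γ · β d 𝒯 ≐ β d′ 𝒯′
  β-action γ d d′ {𝒯} {𝒯′} D′∼ = record
    { source-break = Shift.β-break 𝒯 d
    ; target-break = target-break
    ; equivalent   = D′∼
    ; unique       = λ D″ B D″∼ → break-unique {D″} {D′} B target-break
        (∼-trans {D″} {D+γ} {D′} D″∼ (∼-sym {D′} {D+γ} D′∼))
    }
    where
    D′ D+γ : Divisor
    D′  = β d′ 𝒯′
    D+γ = β d 𝒯 ⊕ proj₁ γ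
    target-break : IsBreak D′
    target-break = Shift.β-break 𝒯′ d′

  -- Passing from `β d₁` to `β d₂` adds the same class `γ₀` for `𝒯` and for `𝒯′`, and adding `γ₀`
  -- commutes with adding `γ`.
  transfer : ∀ d₁ d₂ → end d₁ ≡ end d₂ → ∀ γ {𝒯 𝒯′} → γ ·[ d₁ ] 𝒯 ≐ 𝒯′ → γ ·[ d₂ ] 𝒯 ≐ 𝒯′
  transfer d₁ d₂ p γ {𝒯} {𝒯′} act with (γ₀ , _) , change ← β-change d₁ d₂ p =
    β-action γ d₂ d₂ {𝒯} {𝒯′}
      (∼-trans {β d₂ 𝒯′} {β d₁ 𝒯′ ⊕ γ₀} {β d₂ 𝒯 ⊕ proj₁ γ} (change 𝒯′)
      (∼-trans {β d₁ 𝒯′ ⊕ γ₀} {β d₁ 𝒯 ⊕ proj₁ γ ⊕ γ₀} {β d₂ 𝒯 ⊕ proj₁ γ}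
        (∼-⊕ {β d₁ 𝒯′} {β d₁ 𝒯 ⊕ proj₁ γ} γ₀ (_·_≐_.equivalent act))
      (∼-trans {β d₁ 𝒯 ⊕ proj₁ γ ⊕ γ₀} {β d₁ 𝒯 ⊕ γ₀ ⊕ proj₁ γ} {β d₂ 𝒯 ⊕ proj₁ γ}
        (≗⇒∼ λ u → swap (β d₁ 𝒯 u) (proj₁ γ u) (γ₀ u))
        (∼-⊕ {β d₁ 𝒯 ⊕ γ₀} {β d₂ 𝒯} (proj₁ γ) (∼-sym {β d₂ 𝒯} {β d₁ 𝒯 ⊕ γ₀} (change 𝒯))))))
    where
    swap : ∀ a b c → (a ℤ.+ b) ℤ.+ c ≡ (a ℤ.+ c) ℤ.+ b
    swap = solve-∀

theorem4p1 : (G : RibbonGraph) → let open Bernardi G in (v : Vertex) →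
    ((d₁ d₂ : Dart) → end d₁ ≡ v → end d₂ ≡ v →
    Σ[ γ₀ ∈ Pic⁰ ] ((T : SpanningTree) → γ₀ · β d₁ T ≐ β d₂ T))
    × ((d₁ d₂ : Dart) → end d₁ ≡ v → end d₂ ≡ v →
    (γ : Pic⁰) (T T′ : SpanningTree) →
    (γ ·[ d₁ ] T ≐ T′) ⇔ (γ ·[ d₂ ] T ≐ T′))
theorem4p1 G v =
    (λ d₁ d₂ p₁ p₂ → let γ₀ , change = β-change d₁ d₂ (trans p₁ (sym p₂)) in
      γ₀ , λ T → β-action γ₀ d₁ d₂ {T} {T} (change T))
  , (λ d₁ d₂ p₁ p₂ γ T T′ →
      mk⇔ (transfer d₁ d₂ (trans p₁ (sym p₂)) γ {T} {T′}) (transfer d₂ d₁ (trans p₂ (sym p₁)) γ {T} {T′}))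
  where open Breaks G
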